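{- Let $\mathcal{H}=\{rrb,bby,yyr\}$. Then $h_2(n,\mathcal{H})=\lceil n/2\rceil$ for $n\ne 7$, and $h_2(7,\mathcal{H})=3$.
   Context: Here $n$ denotes the number of vertices of the complete graph $K_n$. Edge-colorings of $K_n$ use colors from $\{r,b,y\}$ (red, blue, yellow); they need not be proper, and not all colors need be used. A pattern is an edge-colored triangle, denoted by the multiset of the colors of its three edges; e.g. $rrb$ is the triangle with two red edges and one blue edge, $bby$ has two blue edges and one yellow edge, $yyr$ has two yellow edges and one red edge. For a family $\mathcal{H}$ of patterns, $\operatorname{Forb}(n,\mathcal{H})$ is the set of all edge-colorings of $K_n$ with colors from $\{r,b,y\}$ in which no triangle has a coloring belonging to $\mathcal{H}$. For an edge-coloring $c$ of $K_n$, $h_2(c)$ is the maximum $k$ such that there is a set of $k$ vertices whose induced edges use at most two of the three colors. Finally, $h_2(n,\mathcal{H})=\min\{h_2(c): c\in\operatorname{Forb}(n,\mathcal{H})\}$.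
   Formalization: The case n = 2 is excluded, since the claim fails there: K_2 has a single edge, so h_2(2,H) = 2, whereas ⌈2/2⌉ = 1. -}

module Defs where

open import Data.Fin using (Fin)
open import Data.Fin.Subset using (Subset; _∈_; ∣_∣)
open import Data.List using (List; []; _∷_)
open import Data.List.Relation.Binary.Permutation.Propositional using (_↭_)
open import Data.List.Relation.Unary.Any using (Any)
open import Data.Nat using (ℕ; _≤_)
open import Data.Product using (∃-syntax; _×_)
open import Data.Sum using (_⊎_)
open import Data.Vec using (Vec; []; _∷_; toList)
open import Relation.Binary.PropositionalEquality using (_≡_; _≢_)
open import Relation.Nullary using (¬_)

data Color : Set where
  r b y : Color

-- The diagonal values `color u u` carry no meaning: every definition below
-- only looks at pairs of distinct vertices.
record EdgeColoring (n : ℕ) : Set where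
  field
    color     : Fin n → Fin n → Color
    color-sym : ∀ u v → color u v ≡ color v u

open EdgeColoring public

-- Patterns are multisets of three colors, i.e. vectors compared up to
-- permutation.
Pattern : Set
Pattern = Vec Color 3

_≋_ : Pattern → Pattern → Set
p ≋ q = toList p ↭ toList q

triangle : ∀ {n} → EdgeColoring n → (u v w : Fin n) → Pattern
triangle c u v w = color c u v ∷ color c v w ∷ color c u w ∷ []

_∈Forb_ : ∀ {n} → EdgeColoring n → List Pattern → Set
c ∈Forb H =
  ∀ u v w → u ≢ v → v ≢ w → u ≢ w → ¬ Any (λ p → triangle c u v w ≋ p) H

-- The two colors k and l are allowed to coincide.
UsesAtMostTwoColors : ∀ {n} → EdgeColoring n → Subset n → Set
UsesAtMostTwoColors c S =
  ∃[ k ] ∃[ l ] (∀ u v → u ∈ S → v ∈ S → u ≢ v → color c u v ≡ k ⊎ color c u v ≡ l)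

IsMaximum : (ℕ → Set) → ℕ → Set
IsMaximum P m = P m × (∀ k → P k → k ≤ m)

IsMinimum : (ℕ → Set) → ℕ → Set
IsMinimum P m = P m × (∀ k → P k → m ≤ k)

-- `h₂[ c ]≡ m` is h₂(c) = m, and `h₂[ n , H ]≡ m` is h₂(n, H) = m.  As
-- relations, they include the assertion that the maximum (resp. minimum) is
-- attained.
h₂[_]≡_ : ∀ {n} → EdgeColoring n → ℕ → Set
h₂[ c ]≡ m =
  IsMaximum (λ k → ∃[ S ] (∣ S ∣ ≡ k × UsesAtMostTwoColors c S)) m

h₂[_,_]≡_ : ℕ → List Pattern → ℕ → Set
h₂[ n , H ]≡ m =
  IsMinimum (λ k → ∃[ c ] (_∈Forb_ {n} c H × h₂[ c ]≡ k)) m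

rrb bby yyr : Pattern
rrb = r ∷ r ∷ b ∷ []
bby = b ∷ b ∷ y ∷ []
yyr = y ∷ y ∷ r ∷ []

{-# OPTIONS --safe #-}
-- With the cyclic order r → b → y → r on colors, a coloring is admissible iff no
-- two edges uv, vw of color k are closed up by an edge uw of the color after k.
--
-- Lower bound.  Let S be a largest two-colored set, with colors r and y up to
-- rotation; it is a disjoint union of yellow cliques joined in red.  Every outside
-- vertex sends a blue edge to S, which leaves it so few ways to attach to S that,
-- once |S| ≥ 4, any two outside vertices have a common neighbour in S restricting
-- the color between them, and the complement of S is two-colored as well; hence
-- n ≤ 2|S|.  For |S| ≤ 3, a vertex together with its neighbours in one color is
-- two-colored, so n - 1 ≤ 3(|S| - 1), which suffices unless n = 7.
--
-- Upper bound.  Split the vertices into two red cliques, join them by a yellow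
-- matching and color the remaining edges blue.  For n = 7, color the edges of
-- ℤ/7 by the differences ±1, ±2, ±3.
module Submission where

open import Defs
open import Data.Empty using (⊥; ⊥-elim)
open import Data.Fin using (Fin; zero; suc; punchOut; toℕ)
open import Data.Fin.Properties using (_≟_; any?; all?; punchOut-injective; suc-injective; 0≢1+n)
open import Data.Fin.Subset using (Subset; inside; outside; _∈_; _∉_; ∣_∣; ∁; _∪_; ⁅_⁆)
open import Data.Fin.Subset.Properties
  using (_∈?_; ∣p∣≤n; ∣∁p∣≡n∸∣p∣; x∈∁p⇒x∉p; p⊆p∪q; x∈p∪q⁺; x∈p∪q⁻; x∈⁅x⁆; x∈⁅y⁆⇒x≡y;
         p⊂q⇒∣p∣<∣q∣; anySubset?; drop-there)
open import Data.List using (List; []; _∷_)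
open import Data.List.Membership.Propositional using () renaming (_∈_ to _∈ˡ_)
open import Data.List.Relation.Binary.Permutation.Propositional
  using (_↭_; prep; swap; ↭-refl; ↭-sym; ↭-trans)
open import Data.List.Relation.Binary.Permutation.Propositional.Properties
  using (All-resp-↭; ∈-resp-↭; drop-∷)
open import Data.List.Relation.Unary.All using ([]; _∷_)
open import Data.List.Relation.Unary.Any using (Any; here; there)
open import Data.Nat using (ℕ; zero; suc; _+_; _∸_; _≤_; _<_; z≤n; s≤s; _≤?_; ⌈_/2⌉; ∣_-_∣)
open import Data.Nat.Properties
  using (≤-trans; ≤-reflexive; ≤-pred; ≤∧≢⇒<; ≮⇒≥; <⇒≱; m≤n+m∸n; +-monoʳ-≤; +-mono-≤; +-suc;
         ⌈n/2⌉-mono; n≡⌈n+n/2⌉; ∣-∣-comm; module ≤-Reasoning)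
open import Data.Product using (∃; ∃-syntax; _×_)
open import Data.Sum using (_⊎_; inj₁; inj₂; [_,_]′) renaming (map to map⊎; swap to swap⊎)
open import Data.Vec using (Vec; []; _∷_; here; there; lookup; tabulate)
open import Data.Vec.Membership.DecPropositional using () renaming (_∈?_ to ∈ᵛ?)
open import Data.Vec.Membership.Propositional using () renaming (_∈_ to _∈ᵛ_)
open import Data.Vec.Properties using (lookup∘tabulate; []=⇒lookup)
open import Data.Vec.Relation.Unary.Any using (here; there; index)
open import Data.Vec.Relation.Unary.Any.Properties using (lookup-index)
open import Function using (id; _∘_)
open import Relation.Binary.PropositionalEquality using (_≡_; _≢_; refl; sym; trans; cong; ≢-sym)
open import Relation.Nullary using (¬_; Dec; yes; no; contradiction)
open import Relation.Nullary.Decidable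
  using (_×-dec_; _⊎-dec_; _→-dec_; ¬?; from-yes; from-no; does; decidable-stable)

-- With the pairing constructor in scope at top level, h₂[ n , H ]≡ m would
-- also parse as h₂[ (n , H) ]≡ m.
module _ where

  open import Data.Product using (_,_)

  -- The cyclic order on the colors.

  next : Color → Color
  next r = b
  next b = y
  next y = r

  next³ : ∀ k → next (next (next k)) ≡ k
  next³ r = refl
  next³ b = refl
  next³ y = refl

  next-injective : ∀ {k l} → next k ≡ next l → k ≡ l
  next-injective {k} {l} e = trans (sym (next³ k)) (trans (cong (next ∘ next) e) (next³ l))

  _≟ᶜ_ : (k l : Color) → Dec (k ≡ l)
  r ≟ᶜ r = yes refl
  r ≟ᶜ b = no λ ()
  r ≟ᶜ y = no λ ()
  b ≟ᶜ r = no λ ()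
  b ≟ᶜ b = yes refl
  b ≟ᶜ y = no λ ()
  y ≟ᶜ r = no λ ()
  y ≟ᶜ b = no λ ()
  y ≟ᶜ y = yes refl

  ≢r⇒b⊎y : ∀ {k} → k ≢ r → k ≡ b ⊎ k ≡ y
  ≢r⇒b⊎y {r} k≢r = contradiction refl k≢r
  ≢r⇒b⊎y {b} _ = inj₁ refl
  ≢r⇒b⊎y {y} _ = inj₂ refl

  ≢b⇒r⊎y : ∀ {k} → k ≢ b → k ≡ r ⊎ k ≡ y
  ≢b⇒r⊎y {r} _ = inj₁ refl
  ≢b⇒r⊎y {b} k≢b = contradiction refl k≢b
  ≢b⇒r⊎y {y} _ = inj₂ refl

  ≢y⇒r⊎b : ∀ {k} → k ≢ y → k ≡ r ⊎ k ≡ b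
  ≢y⇒r⊎b {r} _ = inj₁ refl
  ≢y⇒r⊎b {b} _ = inj₂ refl
  ≢y⇒r⊎b {y} k≢y = contradiction refl k≢y

  missing-color : ∀ (k l : Color) → ∃[ m ] (∀ {j : Color} → j ≡ k ⊎ j ≡ l → j ≢ m)
  missing-color r r = b , λ { (inj₁ refl) () ; (inj₂ refl) () }
  missing-color r b = y , λ { (inj₁ refl) () ; (inj₂ refl) () }
  missing-color r y = b , λ { (inj₁ refl) () ; (inj₂ refl) () }
  missing-color b r = y , λ { (inj₁ refl) () ; (inj₂ refl) () }
  missing-color b b = r , λ { (inj₁ refl) () ; (inj₂ refl) () }
  missing-color b y = r , λ { (inj₁ refl) () ; (inj₂ refl) () }
  missing-color y r = b , λ { (inj₁ refl) () ; (inj₂ refl) () }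
  missing-color y b = r , λ { (inj₁ refl) () ; (inj₂ refl) () }
  missing-color y y = r , λ { (inj₁ refl) () ; (inj₂ refl) () }

  -- Admissible colorings and their rotations.

  forbidden : List Pattern
  forbidden = rrb ∷ bby ∷ yyr ∷ []

  Cyclic : ∀ {n} → EdgeColoring n → Set
  Cyclic c = ∀ {u v w} k → u ≢ v → v ≢ w → u ≢ w →
    color c u v ≡ k → color c v w ≡ k → color c u w ≢ next k

  ∈Forb⇒Cyclic : ∀ {n} {c : EdgeColoring n} → c ∈Forb forbidden → Cyclic c
  ∈Forb⇒Cyclic {c = c} free {u} {v} {w} k u≢v v≢w u≢w uv vw uw = free u v w u≢v v≢w u≢w (go k uv vw uw)
    where
    go : ∀ k → color c u v ≡ k → color c v w ≡ k → color c u w ≡ next k →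
         Any (λ p → triangle c u v w ≋ p) forbidden
    go r uv vw uw rewrite uv | vw | uw = here ↭-refl
    go b uv vw uw rewrite uv | vw | uw = there (here ↭-refl)
    go y uv vw uw rewrite uv | vw | uw = there (there (here ↭-refl))

  ↭-pair : ∀ {j k l : Color} → j ∷ k ∷ [] ↭ l ∷ l ∷ [] → j ≡ l × k ≡ l
  ↭-pair p with All-resp-↭ (↭-sym p) (refl ∷ refl ∷ [])
  ... | j≡l ∷ k≡l ∷ [] = j≡l , k≡l

  -- Locate `m` on the left, bring it to the front on both sides and cancel it; the other two
  -- entries then rearrange `l`, `l`.
  ↭-triple : ∀ {i j k l m : Color} → i ∷ j ∷ k ∷ [] ↭ l ∷ l ∷ m ∷ [] →
    (i ≡ m × j ≡ l × k ≡ l) ⊎ (j ≡ m × i ≡ l × k ≡ l) ⊎ (k ≡ m × i ≡ l × j ≡ l)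
  ↭-triple {i} {j} {k} {l} {m} p = go (∈-resp-↭ (↭-sym p) (there (there (here refl))))
    where
    p′ : i ∷ j ∷ k ∷ [] ↭ m ∷ l ∷ l ∷ []
    p′ = ↭-trans p (↭-trans (prep l (swap l m ↭-refl)) (swap l m ↭-refl))
    go : m ∈ˡ i ∷ j ∷ k ∷ [] → _
    go (here refl) = inj₁ (refl , ↭-pair (drop-∷ p′))
    go (there (here refl)) = inj₂ (inj₁ (refl , ↭-pair (drop-∷ (↭-trans (swap m i ↭-refl) p′))))
    go (there (there (here refl))) =
      inj₂ (inj₂ (refl , ↭-pair (drop-∷ (↭-trans (swap m i ↭-refl) (↭-trans (prep i (swap m j ↭-refl)) p′)))))

  Cyclic⇒∈Forb : ∀ {n} {c : EdgeColoring n} → Cyclic c → c ∈Forb forbidden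
  Cyclic⇒∈Forb {c = c} cyc u v w u≢v v≢w u≢w = λ where
      (here p) → go r p
      (there (here p)) → go b p
      (there (there (here p))) → go y p
    where
    rev : ∀ {s t k} → color c s t ≡ k → color c t s ≡ k
    rev = trans (color-sym c _ _)
    go : ∀ k → triangle c u v w ≋ (k ∷ k ∷ next k ∷ []) → ⊥
    go k p with ↭-triple p
    -- Each case orders the vertices so that the two edges of color `k` meet in the middle one.
    ... | inj₁ (uv , vw , uw) = cyc k u≢w (≢-sym v≢w) u≢v uw (rev vw) uv
    ... | inj₂ (inj₁ (vw , uv , uw)) = cyc k (≢-sym u≢v) u≢w v≢w (rev uv) uw vw
    ... | inj₂ (inj₂ (uw , uv , vw)) = cyc k u≢v v≢w u≢w uv vw uw

  -- `next` permutes the three forbidden patterns, so rotation preserves admissibility and carries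
  -- any pair of colors to red and yellow.
  rotate : ∀ {n} → EdgeColoring n → EdgeColoring n
  rotate c .color u v = next (color c u v)
  rotate c .color-sym u v = cong next (color-sym c u v)

  rotate-cyclic : ∀ {n} {c : EdgeColoring n} → Cyclic c → Cyclic (rotate c)
  rotate-cyclic cyc k u≢v v≢w u≢w refl vw uw =
    cyc _ u≢v v≢w u≢w refl (next-injective vw) (next-injective uw)

  Uses : ∀ {n} → EdgeColoring n → Subset n → Color → Color → Set
  Uses c S k l = ∀ u v → u ∈ S → v ∈ S → u ≢ v → color c u v ≡ k ⊎ color c u v ≡ l

  unrotate-two-colored : ∀ {n} {c : EdgeColoring n} {S} →
    UsesAtMostTwoColors (rotate c) S → UsesAtMostTwoColors c S
  unrotate-two-colored (k , l , uses) = next (next k) , next (next l) , λ u v u∈S v∈S u≢v →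
    [ (λ e → inj₁ (back e)) , (λ e → inj₂ (back e)) ]′ (uses u v u∈S v∈S u≢v)
    where
    back : ∀ {j m} → next j ≡ m → j ≡ next (next m)
    back {j} e = trans (sym (next³ j)) (cong (next ∘ next) e)

  -- Counting in subsets.

  injective-on⇒∣p∣≤ : ∀ {n m} (S : Subset n) (f : ∀ u → u ∈ S → Fin m) →
    (∀ {u v} (u∈S : u ∈ S) (v∈S : v ∈ S) → f u u∈S ≡ f v v∈S → u ≡ v) → ∣ S ∣ ≤ m
  injective-on⇒∣p∣≤ [] f inj = z≤n
  injective-on⇒∣p∣≤ (outside ∷ S) f inj =
    injective-on⇒∣p∣≤ S (λ u u∈S → f (suc u) (there u∈S))
      (λ u∈S v∈S e → suc-injective (inj (there u∈S) (there v∈S) e))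
  injective-on⇒∣p∣≤ {m = zero} (inside ∷ S) f inj with () ← f zero here
  injective-on⇒∣p∣≤ {m = suc m} (inside ∷ S) f inj =
    s≤s (injective-on⇒∣p∣≤ S (λ u u∈S → punchOut (f0≢ u∈S))
      (λ u∈S v∈S e → suc-injective (inj (there u∈S) (there v∈S)
        (punchOut-injective (f0≢ u∈S) (f0≢ v∈S) e))))
    where
    f0≢ : ∀ {u} (u∈S : u ∈ S) → f zero here ≢ f (suc u) (there u∈S)
    f0≢ u∈S e = 0≢1+n (inj here (there u∈S) e)

  -- If every member of `S` occurred in `xs`, its position there would embed `S` into `Fin m`.
  ∃-avoiding : ∀ {n m} (S : Subset n) → m < ∣ S ∣ → (xs : Vec (Fin n) m) → ∃[ z ] (z ∈ S × ¬ (z ∈ᵛ xs))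
  ∃-avoiding S m<∣S∣ xs with any? (λ z → (z ∈? S) ×-dec ¬? (∈ᵛ? _≟_ z xs))
  ... | yes found = found
  ... | no none = ⊥-elim (<⇒≱ m<∣S∣ (injective-on⇒∣p∣≤ S (λ z z∈S → index (mem z∈S)) inj))
    where
    mem : ∀ {z} → z ∈ S → z ∈ᵛ xs
    mem {z} z∈S with ∈ᵛ? _≟_ z xs
    ... | yes z∈xs = z∈xs
    ... | no z∉xs = ⊥-elim (none (z , z∈S , z∉xs))
    inj : ∀ {u v} (u∈S : u ∈ S) (v∈S : v ∈ S) → index (mem u∈S) ≡ index (mem v∈S) → u ≡ v
    inj u∈S v∈S e = trans (lookup-index (mem u∈S))
      (trans (cong (lookup xs) e) (sym (lookup-index (mem v∈S))))

  -- A maximal red-yellow set and the vertices outside it.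

  Unextendable : ∀ {n} → EdgeColoring n → Subset n → Set
  Unextendable c S = ∀ {v} → v ∉ S → ¬ UsesAtMostTwoColors c (S ∪ ⁅ v ⁆)

  module RedYellow {n} (c : EdgeColoring n) (cyc : Cyclic c) (S : Subset n)
    (uses : Uses c S r y) (maximal : Unextendable c S) (large : 4 ≤ ∣ S ∣) where

    private
      variable
        p q u v w z : Fin n
        j k l : Color

    rev : color c u v ≡ k → color c v u ≡ k
    rev = trans (color-sym c _ _)

    clash : j ≢ k → color c u v ≡ j → color c u v ≢ k
    clash j≢k e f = j≢k (trans (sym e) f)

    out≢in : w ∉ S → p ∈ S → w ≢ p
    out≢in w∉S p∈S refl = w∉S p∈S

    in≢out : w ∉ S → p ∈ S → p ≢ w
    in≢out w∉S p∈S refl = w∉S p∈S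

    avoid₃ : ∀ p q w → ∃[ z ] (z ∈ S × z ≢ p × z ≢ q × z ≢ w)
    avoid₃ p q w with ∃-avoiding S large (p ∷ q ∷ w ∷ [])
    ... | z , z∈S , z∉ = z , z∈S , (λ e → z∉ (here e)) ,
      (λ e → z∉ (there (here e))) , (λ e → z∉ (there (there (here e))))

    -- Otherwise `w` could be added to `S`. The colors are parameters because an all-yellow `S` is
    -- also tested with blue and yellow.
    escape : w ∉ S → ∀ k l → Uses c S k l → ∃[ z ] (z ∈ S × color c w z ≢ k × color c w z ≢ l)
    escape {w} w∉S k l S-uses
      with any? (λ z → (z ∈? S) ×-dec (¬? (color c w z ≟ᶜ k) ×-dec ¬? (color c w z ≟ᶜ l)))
    ... | yes found = found
    ... | no none = ⊥-elim (maximal w∉S (k , l , extended))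
      where
      to-w : z ∈ S → color c w z ≡ k ⊎ color c w z ≡ l
      to-w {z} z∈S with color c w z ≟ᶜ k | color c w z ≟ᶜ l
      ... | yes e | _ = inj₁ e
      ... | no _ | yes e = inj₂ e
      ... | no f | no g = ⊥-elim (none (z , z∈S , f , g))
      extended : Uses c (S ∪ ⁅ w ⁆) k l
      extended u v u∈ v∈ u≢v with x∈p∪q⁻ S ⁅ w ⁆ u∈ | x∈p∪q⁻ S ⁅ w ⁆ v∈
      ... | inj₁ u∈S | inj₁ v∈S = S-uses u v u∈S v∈S u≢v
      ... | inj₁ u∈S | inj₂ v∈w rewrite x∈⁅y⁆⇒x≡y w v∈w | color-sym c u w = to-w u∈S
      ... | inj₂ u∈w | inj₁ v∈S rewrite x∈⁅y⁆⇒x≡y w u∈w = to-w v∈S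
      ... | inj₂ u∈w | inj₂ v∈w =
        contradiction (trans (x∈⁅y⁆⇒x≡y w u∈w) (sym (x∈⁅y⁆⇒x≡y w v∈w))) u≢v

    blue-neighbour : w ∉ S → ∃[ z ] (z ∈ S × color c w z ≡ b)
    blue-neighbour {w} w∉S with escape w∉S r y uses
    ... | z , z∈S , ≢r , ≢y = z , z∈S , [ id , (λ e → contradiction e ≢y) ]′ (≢r⇒b⊎y ≢r)

    infix 4 _~_
    _~_ : Fin n → Fin n → Set
    p ~ q = p ≡ q ⊎ color c p q ≡ y

    ~-sym : p ~ q → q ~ p
    ~-sym (inj₁ e) = inj₁ (sym e)
    ~-sym (inj₂ e) = inj₂ (rev e)

    _~?_ : ∀ p q → Dec (p ~ q)
    p ~? q with p ≟ q | color c p q ≟ᶜ y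
    ... | yes e | _ = yes (inj₁ e)
    ... | no _ | yes e = yes (inj₂ e)
    ... | no f | no g = no [ f , g ]′

    -- yyr is forbidden, so within S yellow is transitive: S is a union of
    -- yellow cliques with red between them.
    ~-trans : p ∈ S → w ∈ S → p ~ q → q ~ w → p ~ w
    ~-trans _ _ (inj₁ refl) qw = qw
    ~-trans _ _ pq (inj₁ refl) = pq
    ~-trans {p} {w} {q} p∈S w∈S (inj₂ pq) (inj₂ qw) with p ≟ w
    ... | yes e = inj₁ e
    ... | no p≢w with p ≟ q | q ≟ w
    ...   | yes refl | _ = inj₂ qw
    ...   | no _ | yes refl = inj₂ pq
    ...   | no p≢q | no q≢w with uses p w p∈S w∈S p≢w
    ...     | inj₁ pw = contradiction pw (cyc y p≢q q≢w p≢w pq qw)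
    ...     | inj₂ pw = inj₂ pw

    -- This rule and the next three each exclude one triangle with apex `w`. Together: a clique gets
    -- at most one blue edge from `w`, all yellow edges go to one clique, red and blue share a
    -- clique, red and yellow never do.
    blue-blue : w ∉ S → p ∈ S → q ∈ S → color c w p ≡ b → color c w q ≡ b → p ~ q → p ≡ q
    blue-blue _ _ _ _ _ (inj₁ e) = e
    blue-blue {w} {p} {q} w∉S p∈S q∈S wp wq (inj₂ pq) with p ≟ q
    ... | yes e = e
    ... | no p≢q = contradiction pq (cyc b (in≢out w∉S p∈S) (out≢in w∉S q∈S) p≢q (rev wp) wq)

    yellow-yellow : w ∉ S → p ∈ S → q ∈ S → color c w p ≡ y → color c w q ≡ y → p ~ q
    yellow-yellow {w} {p} {q} w∉S p∈S q∈S wp wq with p ≟ q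
    ... | yes e = inj₁ e
    ... | no p≢q with uses p q p∈S q∈S p≢q
    ...   | inj₁ pq = contradiction pq (cyc y (in≢out w∉S p∈S) (out≢in w∉S q∈S) p≢q (rev wp) wq)
    ...   | inj₂ pq = inj₂ pq

    red-blue : w ∉ S → p ∈ S → q ∈ S → color c w p ≡ r → color c w q ≡ b → p ~ q
    red-blue {w} {p} {q} w∉S p∈S q∈S wp wq with p ≟ q
    ... | yes e = inj₁ e
    ... | no p≢q with uses p q p∈S q∈S p≢q
    ...   | inj₁ pq = contradiction wq (cyc r (out≢in w∉S p∈S) p≢q (out≢in w∉S q∈S) wp pq)
    ...   | inj₂ pq = inj₂ pq

    red-yellow : w ∉ S → p ∈ S → q ∈ S → color c w p ≡ r → color c w q ≡ y → ¬ p ~ q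
    red-yellow w∉S p∈S q∈S wp wq (inj₁ refl) = clash (λ ()) wp wq
    red-yellow {w} {p} {q} w∉S p∈S q∈S wp wq (inj₂ pq) with p ≟ q
    ... | yes refl = clash (λ ()) wp wq
    ... | no p≢q = contradiction wp (cyc y (out≢in w∉S q∈S) (≢-sym p≢q) (out≢in w∉S p∈S) wq (rev pq))

    both-yellow : u ∉ S → v ∉ S → z ∈ S → u ≢ v → color c u z ≡ y → color c v z ≡ y → color c u v ≢ r
    both-yellow u∉S v∉S z∈S u≢v uz vz = cyc y (out≢in u∉S z∈S) (in≢out v∉S z∈S) u≢v uz (rev vz)

    -- Membership of `z` in `S` is replaced by distinctness, since the two-clique case uses common
    -- red neighbours outside `S`.
    both-red : z ≢ u → z ≢ v → u ≢ v → color c u z ≡ r → color c v z ≡ r → color c u v ≢ b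
    both-red z≢u z≢v u≢v uz vz = cyc r (≢-sym z≢u) z≢v u≢v uz (rev vz)

    both-blue : u ∉ S → v ∉ S → z ∈ S → u ≢ v → color c u z ≡ b → color c v z ≡ b → color c u v ≢ y
    both-blue u∉S v∉S z∈S u≢v uz vz = cyc b (out≢in u∉S z∈S) (in≢out v∉S z∈S) u≢v uz (rev vz)

    -- How an outside vertex with a red edge into `S` must attach. Its yellow edges reach only one
    -- clique, so `S` then has at most two cliques.
    record Reddish (w q : Fin n) : Set where
      field
        base∈ : q ∈ S
        blue  : color c w q ≡ b
        red   : ∀ {z} → z ∈ S → z ~ q → z ≢ q → color c w z ≡ r
        yellow : ∀ {z} → z ∈ S → ¬ z ~ q → color c w z ≡ y

    -- A single red edge from w to S determines all the others up to the choice
    -- of the blue one.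
    reddish : w ∉ S → p ∈ S → color c w p ≡ r → ∃ (Reddish w)
    reddish {w} {p} w∉S p∈S wp with blue-neighbour w∉S
    ... | q , q∈S , wq = q , record { base∈ = q∈S ; blue = wq ; red = red′ ; yellow = yellow′ }
      where
      p~q : p ~ q
      p~q = red-blue w∉S p∈S q∈S wp wq
      red′ : ∀ {z} → z ∈ S → z ~ q → z ≢ q → color c w z ≡ r
      red′ {z} z∈S z~q z≢q with color c w z in wz
      ... | r = refl
      ... | b = contradiction (blue-blue w∉S z∈S q∈S wz wq z~q) z≢q
      ... | y = contradiction (~-trans p∈S z∈S p~q (~-sym z~q)) (red-yellow w∉S p∈S z∈S wp wz)
      yellow′ : ∀ {z} → z ∈ S → ¬ z ~ q → color c w z ≡ y
      yellow′ {z} z∈S z≁q with color c w z in wz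
      ... | r = contradiction (red-blue w∉S z∈S q∈S wz wq) z≁q
      ... | b = contradiction (~-trans z∈S q∈S (~-sym (red-blue w∉S p∈S z∈S wp wz)) p~q) z≁q
      ... | y = refl

    open Reddish

    red-neighbour? : ∀ w → Dec (∃[ p ] (p ∈ S × color c w p ≡ r))
    red-neighbour? w = any? λ p → (p ∈? S) ×-dec (color c w p ≟ᶜ r)

    TwoColoredComplement : Set
    TwoColoredComplement = UsesAtMostTwoColors c (∁ S)

    outside-avoids : ∀ k → (∀ u v → u ∉ S → v ∉ S → u ≢ v → color c u v ≢ k) → TwoColoredComplement
    outside-avoids r f = b , y , λ u v u∈ v∈ u≢v → ≢r⇒b⊎y (f u v (x∈∁p⇒x∉p u∈) (x∈∁p⇒x∉p v∈) u≢v)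
    outside-avoids b f = r , y , λ u v u∈ v∈ u≢v → ≢b⇒r⊎y (f u v (x∈∁p⇒x∉p u∈) (x∈∁p⇒x∉p v∈) u≢v)
    outside-avoids y f = r , b , λ u v u∈ v∈ u≢v → ≢y⇒r⊎b (f u v (x∈∁p⇒x∉p u∈) (x∈∁p⇒x∉p v∈) u≢v)

    -- Case: no red edge joins `S` to its complement.

    module NoRed (no-red : ∀ {w p} → w ∉ S → p ∈ S → color c w p ≢ r) where

      yellow-off : w ∉ S → p ∈ S → q ∈ S → color c w q ≡ b → p ~ q → p ≢ q → color c w p ≡ y
      yellow-off {w} {p} w∉S p∈S q∈S wq p~q p≢q with ≢r⇒b⊎y (no-red w∉S p∈S)
      ... | inj₁ wp = contradiction (blue-blue w∉S p∈S q∈S wp wq p~q) p≢q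
      ... | inj₂ wp = wp

      -- Across a yellow outside edge vw no vertex of S is blue to both ends, so
      -- S is covered by two yellow neighbourhoods, which turn out to meet.
      module YellowPair (v∉S : v ∉ S) (w∉S : w ∉ S) (v≢w : v ≢ w) (vw : color c v w ≡ y) where

        y-of-b : ∀ {s t z} → s ∉ S → t ∉ S → s ≢ t → color c s t ≡ y → z ∈ S →
          color c s z ≡ b → color c t z ≡ y
        y-of-b s∉S t∉S s≢t st z∈S sz with ≢r⇒b⊎y (no-red t∉S z∈S)
        ... | inj₁ tz = contradiction st (both-blue s∉S t∉S z∈S s≢t sz tz)
        ... | inj₂ tz = tz

        -- Two blue neighbours of `s` would both be yellow to `t`, hence in one clique, which has
        -- room for only one blue edge from `s`.
        off-blue : ∀ {s t z q} → s ∉ S → t ∉ S → s ≢ t → color c s t ≡ y → z ∈ S → q ∈ S →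
          color c s q ≡ b → z ≢ q → color c s z ≡ y
        off-blue s∉S t∉S s≢t st z∈S q∈S sq z≢q with ≢r⇒b⊎y (no-red s∉S z∈S)
        ... | inj₂ sz = sz
        ... | inj₁ sz = contradiction (blue-blue s∉S z∈S q∈S sz sq
          (yellow-yellow t∉S z∈S q∈S (y-of-b s∉S t∉S s≢t st z∈S sz) (y-of-b s∉S t∉S s≢t st q∈S sq))) z≢q

        meet : ∃[ z ] (z ∈ S × color c v z ≡ y × color c w z ≡ y)
        meet with blue-neighbour v∉S | blue-neighbour w∉S
        -- Only two vertices need avoiding; `q` is repeated to fill the third slot.
        ... | q , q∈S , vq | q′ , q′∈S , wq′ with avoid₃ q q′ q
        ...   | z , z∈S , z≢q , z≢q′ , _ =
          z , z∈S , off-blue v∉S w∉S v≢w vw z∈S q∈S vq z≢q ,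
            off-blue w∉S v∉S (≢-sym v≢w) (rev vw) z∈S q′∈S wq′ z≢q′

        clique : p ∈ S → q ∈ S → p ~ q
        clique p∈S q∈S with meet
        ... | z , z∈S , vz , wz = ~-trans p∈S q∈S (to-z p∈S) (~-sym (to-z q∈S))
          where
          to-z : ∀ {s} → s ∈ S → s ~ z
          to-z s∈S with ≢r⇒b⊎y (no-red v∉S s∈S)
          ... | inj₂ vs = yellow-yellow v∉S s∈S z∈S vs vz
          ... | inj₁ vs = yellow-yellow w∉S s∈S z∈S (y-of-b v∉S w∉S v≢w vw s∈S vs) wz

        conclusion : TwoColoredComplement
        conclusion = outside-avoids r no-red-outside
          where
          no-red-outside : ∀ u u′ → u ∉ S → u′ ∉ S → u ≢ u′ → color c u u′ ≢ r
          no-red-outside u u′ u∉S u′∉S u≢u′ with blue-neighbour u∉S | blue-neighbour u′∉S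
          -- `S` is a single clique, so away from their blue neighbours both `u` and `u′` send only
          -- yellow edges to `S`.
          ... | q , q∈S , uq | q′ , q′∈S , u′q′ with avoid₃ q q′ q
          ...   | z , z∈S , z≢q , z≢q′ , _ = both-yellow u∉S u′∉S z∈S u≢u′
            (yellow-off u∉S z∈S q∈S uq (clique z∈S q∈S) z≢q)
            (yellow-off u′∉S z∈S q′∈S u′q′ (clique z∈S q′∈S) z≢q′)

      conclusion : TwoColoredComplement
      conclusion with any? (λ v → any? (λ w →
        ¬? (v ∈? S) ×-dec (¬? (w ∈? S) ×-dec (¬? (v ≟ w) ×-dec (color c v w ≟ᶜ y)))))
      ... | yes (v , w , v∉S , w∉S , v≢w , vw) = YellowPair.conclusion v∉S w∉S v≢w vw
      ... | no none = outside-avoids y λ u v u∉S v∉S u≢v uv → none (u , v , u∉S , v∉S , u≢v , uv)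

    -- Case: `S` is a single yellow clique.

    module OneClique (clique : ∀ {p q} → p ∈ S → q ∈ S → p ~ q) where

      -- An all-yellow `S` also counts as a blue-yellow set, so maximality forces a red edge from
      -- `w`.
      everywhere-reddish : w ∉ S → ∃ (Reddish w)
      everywhere-reddish {w} w∉S with escape w∉S b y
        (λ p q p∈S q∈S p≢q → [ (λ e → contradiction e p≢q) , inj₂ ]′ (clique p∈S q∈S))
      ... | p , p∈S , ≢b , ≢y = reddish w∉S p∈S ([ id , (λ e → contradiction e ≢y) ]′ (≢b⇒r⊎y ≢b))

      -- A vertex of the clique other than the two blue base points is red to both outside vertices,
      -- which excludes blue between them.
      conclusion : TwoColoredComplement
      conclusion = outside-avoids b no-blue
        where
        no-blue : ∀ u v → u ∉ S → v ∉ S → u ≢ v → color c u v ≢ b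
        no-blue u v u∉S v∉S u≢v with everywhere-reddish u∉S | everywhere-reddish v∉S
        ... | q , ru | q′ , rv with avoid₃ q q′ q
        ...   | z , z∈S , z≢q , z≢q′ , _ = both-red (in≢out u∉S z∈S) (in≢out v∉S z∈S) u≢v
          (red ru z∈S (clique z∈S (base∈ ru)) z≢q) (red rv z∈S (clique z∈S (base∈ rv)) z≢q′)

    -- Case: `S` consists of two yellow cliques, those of `x` and `t`.

    module TwoCliques {v₀ x x′ t : Fin n} (v₀∉S : v₀ ∉ S) (rv₀ : Reddish v₀ x)
      (x′∈S : x′ ∈ S) (x′~x : x′ ~ x) (x′≢x : x′ ≢ x)
      (t∈S : t ∈ S) (v₀t : color c v₀ t ≡ y) where

      x∈S : x ∈ S
      x∈S = base∈ rv₀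

      t≁x : ¬ t ~ x
      t≁x t~x with t ≟ x
      ... | yes refl = clash (λ ()) (blue rv₀) v₀t
      ... | no t≢x = clash (λ ()) (red rv₀ t∈S t~x t≢x) v₀t

      -- Whatever lies off the clique of `x` is yellow to `v₀`, as is `t`, and yellow neighbours of
      -- `v₀` share a clique.
      side : z ∈ S → z ~ x ⊎ z ~ t
      side {z} z∈S with z ~? x
      ... | yes e = inj₁ e
      ... | no z≁x = inj₂ (yellow-yellow v₀∉S z∈S t∈S (yellow rv₀ z∈S z≁x) v₀t)

      separate : p ∈ S → q ∈ S → p ~ x → q ~ t → ¬ p ~ q
      separate p∈S q∈S p~x q~t p~q =
        t≁x (~-trans t∈S x∈S (~-trans t∈S p∈S (~-sym q~t) (~-sym p~q)) p~x)

      Lonely : Set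
      Lonely = ∀ {z} → z ∈ S → z ~ t → z ≡ t

      -- The outside vertices attached to `S` in the manner of `v₀`; their base point may be any
      -- vertex of the clique of `x`.
      First : Fin n → Set
      First w = color c w t ≡ y × ∃[ p ] (p ~ x × Reddish w p)

      -- slip is the only vertex of the clique of x that might not be yellow to w;
      -- the value slip = t stands for no exception at all.
      record Second (w : Fin n) : Set where
        field
          slip hub : Fin n
          hub∈     : hub ∈ S
          hub~t    : hub ~ t
          hub-blue : color c w hub ≡ b
          slip-side : slip ~ t ⊎ Lonely
          yellow-off-slip : ∀ {z} → z ∈ S → z ~ x → z ≢ slip → color c w z ≡ y

      open Second

      -- If `q` lies in the clique of `t`, one of `x` and `x′` differs from `p`. If that clique is
      -- just `t`, the bound `4 ≤ ∣ S ∣` leaves at least three vertices in the clique of `x`.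
      pick : q ~ t ⊎ Lonely → ∀ p → ∃[ z ] (z ∈ S × z ~ x × z ≢ q × z ≢ p)
      pick {q} (inj₁ q~t) p with x ≟ p
      ... | no x≢p = x , x∈S , inj₁ refl , (λ { refl → t≁x (~-sym q~t) }) , x≢p
      ... | yes refl = x′ , x′∈S , x′~x ,
        (λ { refl → t≁x (~-trans t∈S x∈S (~-sym q~t) x′~x) }) , x′≢x
      pick {q} (inj₂ lonely) p with avoid₃ q p t
      ... | z , z∈S , z≢q , z≢p , z≢t =
        z , z∈S , [ id , (λ z~t → contradiction (lonely z∈S z~t) z≢t) ]′ (side z∈S) , z≢q , z≢p

      pick₂ : ∀ {q q′} → q ~ t ⊎ Lonely → q′ ~ t ⊎ Lonely → ∃[ z ] (z ∈ S × z ~ x × z ≢ q × z ≢ q′)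
      pick₂ {q} {q′} (inj₁ q~t) q′s with pick q′s q
      ... | z , z∈S , z~x , z≢q′ , z≢q = z , z∈S , z~x , z≢q , z≢q′
      pick₂ {q} {q′} (inj₂ lonely) _ = pick (inj₂ lonely) q′

      classify : w ∉ S → First w ⊎ Second w
      classify {w} w∉S with red-neighbour? w
      classify {w} w∉S | yes (p , p∈S , wp) with reddish w∉S p∈S wp
      ... | q , rw with side (base∈ rw)
      ...   | inj₁ q~x = inj₁ (yellow rw t∈S (λ t~q → t≁x (~-trans t∈S x∈S t~q q~x)) , q , q~x , rw)
      ...   | inj₂ q~t = inj₂ record
        { slip = t ; hub∈ = base∈ rw ; hub~t = q~t ; hub-blue = blue rw ; slip-side = inj₁ (inj₁ refl)
        ; yellow-off-slip = λ z∈S z~x _ → yellow rw z∈S (separate z∈S (base∈ rw) z~x q~t) }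
      classify {w} w∉S | no no-red with any? (λ q → (q ∈? S) ×-dec ((q ~? x) ×-dec (color c w q ≟ᶜ b)))
      -- The rest of the clique of `x` is yellow to `w`, so no vertex in the clique of `t` can be.
      -- That clique is therefore all blue to `w`, hence a single vertex.
      ... | yes (q , q∈S , q~x , wq) = inj₂ record
        { slip = q ; hub∈ = t∈S ; hub~t = inj₁ refl ; hub-blue = blue-at-t t∈S (inj₁ refl)
        ; slip-side = inj₂ λ z∈S z~t → blue-blue w∉S z∈S t∈S (blue-at-t z∈S z~t) (blue-at-t t∈S (inj₁ refl)) z~t
        ; yellow-off-slip = yellow-off }
        where
        yellow-off : ∀ {z} → z ∈ S → z ~ x → z ≢ q → color c w z ≡ y
        yellow-off {z} z∈S z~x z≢q with ≢r⇒b⊎y (λ wz → no-red (z , z∈S , wz))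
        ... | inj₂ wz = wz
        ... | inj₁ wz = contradiction
          (blue-blue w∉S z∈S q∈S wz wq (~-trans z∈S q∈S z~x (~-sym q~x))) z≢q
        other : ∃[ p ] (p ∈ S × p ~ x × p ≢ q)
        other with x ≟ q
        ... | yes refl = x′ , x′∈S , x′~x , x′≢x
        ... | no x≢q = x , x∈S , inj₁ refl , x≢q
        blue-at-t : ∀ {z} → z ∈ S → z ~ t → color c w z ≡ b
        blue-at-t {z} z∈S z~t with ≢r⇒b⊎y (λ wz → no-red (z , z∈S , wz)) | other
        ... | inj₁ wz | _ = wz
        ... | inj₂ wz | p , p∈S , p~x , p≢q = contradiction
          (yellow-yellow w∉S p∈S z∈S (yellow-off p∈S p~x p≢q) wz) (separate p∈S z∈S p~x z~t)
      ... | no no-blue with blue-neighbour w∉S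
      ...   | q′ , q′∈S , wq′ with side q′∈S
      ...     | inj₁ q′~x = ⊥-elim (no-blue (q′ , q′∈S , q′~x , wq′))
      ...     | inj₂ q′~t = inj₂ record
        { slip = t ; hub∈ = q′∈S ; hub~t = q′~t ; hub-blue = wq′ ; slip-side = inj₁ (inj₁ refl)
        ; yellow-off-slip = λ {z} z∈S z~x _ →
            [ (λ wz → ⊥-elim (no-blue (z , z∈S , z~x , wz))) , (λ wz → wz) ]′
              (≢r⇒b⊎y (λ wz → no-red (z , z∈S , wz))) }

      -- A vertex in the clique of `x` that is red to `u` and yellow to `w` excludes yellow; the
      -- hub, blue to `w` and yellow to `u`, excludes blue.
      first-second : u ∉ S → w ∉ S → First u → Second w → u ≢ w × color c u w ≡ r
      first-second {u} {w} u∉S w∉S (_ , p , p~x , ru) sw with pick (slip-side sw) p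
      ... | z , z∈S , z~x , z≢q , z≢p = u≢w , [ id , (λ e → contradiction e ≢b) ]′ (≢y⇒r⊎b ≢y)
        where
        uz : color c u z ≡ r
        uz = red ru z∈S (~-trans z∈S (base∈ ru) z~x (~-sym p~x)) z≢p
        wz : color c w z ≡ y
        wz = yellow-off-slip sw z∈S z~x z≢q
        uq′ : color c u (hub sw) ≡ y
        uq′ = yellow ru (hub∈ sw) (λ e → separate (base∈ ru) (hub∈ sw) p~x (hub~t sw) (~-sym e))
        u≢w : u ≢ w
        u≢w refl = clash (λ ()) uz wz
        ≢y : color c u w ≢ y
        ≢y uw = cyc y u≢w (out≢in w∉S z∈S) (out≢in u∉S z∈S) uw wz uz
        ≢b : color c u w ≢ b
        ≢b uw = cyc b u≢w (out≢in w∉S (hub∈ sw)) (out≢in u∉S (hub∈ sw)) uw (hub-blue sw) uq′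

      v₀-first : First v₀
      v₀-first = v₀t , x , inj₁ refl , rv₀

      -- If every outside vertex is yellow to `t`, red is excluded outside. Otherwise some `w` is
      -- `Second`, and blue is excluded: mixed pairs are red, two `First` vertices have `w` as
      -- common red neighbour, and two `Second` vertices have `v₀`.
      conclusion : TwoColoredComplement
      conclusion with any? (λ w → ¬? (w ∈? S) ×-dec ¬? (color c w t ≟ᶜ y))
      ... | no none = outside-avoids r λ u v u∉S v∉S u≢v →
        both-yellow u∉S v∉S t∈S u≢v (at-t u∉S) (at-t v∉S)
        where
        at-t : ∀ {w} → w ∉ S → color c w t ≡ y
        at-t {w} w∉S with color c w t ≟ᶜ y
        ... | yes e = e
        ... | no f = ⊥-elim (none (w , w∉S , f))
      ... | yes (w , w∉S , wt≢y) with classify w∉S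
      ...   | inj₁ (wt , _) = contradiction wt wt≢y
      ...   | inj₂ sw = outside-avoids b no-blue
        where
        no-blue : ∀ u v → u ∉ S → v ∉ S → u ≢ v → color c u v ≢ b
        no-blue u v u∉S v∉S u≢v uv with classify u∉S | classify v∉S
        ... | inj₁ fu | inj₂ sv with first-second u∉S v∉S fu sv
        ...   | _ , e = clash (λ ()) e uv
        no-blue u v u∉S v∉S u≢v uv | inj₂ su | inj₁ fv with first-second v∉S u∉S fv su
        ...   | _ , e = clash (λ ()) e (rev uv)
        no-blue u v u∉S v∉S u≢v uv | inj₁ fu | inj₁ fv
          with first-second u∉S w∉S fu sw | first-second v∉S w∉S fv sw
        ...   | u≢w , uw | v≢w , vw = both-red (≢-sym u≢w) (≢-sym v≢w) u≢v uw vw uv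
        no-blue u v u∉S v∉S u≢v uv | inj₂ su | inj₂ sv
          with first-second v₀∉S u∉S v₀-first su | first-second v₀∉S v∉S v₀-first sv
        ...   | v₀≢u , v₀u | v₀≢v , v₀v = both-red v₀≢u v₀≢v u≢v (rev v₀u) (rev v₀v) uv

    complement-two-colored : TwoColoredComplement
    complement-two-colored with any? (λ w → ¬? (w ∈? S) ×-dec red-neighbour? w)
    ... | no none = NoRed.conclusion (λ {w} {p} w∉S p∈S wp → none (w , w∉S , p , p∈S , wp))
    ... | yes (v₀ , v₀∉S , p , p∈S , v₀p) with reddish v₀∉S p∈S v₀p
    ...   | x , rv₀ with any? (λ t → (t ∈? S) ×-dec (color c v₀ t ≟ᶜ y))
    -- The red neighbour `p` plays the role of `x′`, a second vertex in the clique of `x`.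
    ...     | yes (t , t∈S , v₀t) = TwoCliques.conclusion v₀∉S rv₀ p∈S
      (red-blue v₀∉S p∈S (base∈ rv₀) v₀p (blue rv₀))
      (λ { refl → clash (λ ()) v₀p (blue rv₀) }) t∈S v₀t
    ...     | no none = OneClique.conclusion λ p∈S q∈S →
      ~-trans p∈S q∈S (to-x p∈S) (~-sym (to-x q∈S))
      where
      to-x : ∀ {z} → z ∈ S → z ~ x
      to-x {z} z∈S with z ~? x
      ... | yes e = e
      ... | no z≁x = ⊥-elim (none (z , z∈S , yellow rv₀ z∈S z≁x))

  -- Lower bounds for `h₂`.

  HasTwoColoredSet : ∀ {n} → EdgeColoring n → ℕ → Set
  HasTwoColoredSet c k = ∃[ S ] (∣ S ∣ ≡ k × UsesAtMostTwoColors c S)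

  maximum⇒unextendable : ∀ {n} {c : EdgeColoring n} {S} →
    (∀ k → HasTwoColoredSet c k → k ≤ ∣ S ∣) → Unextendable c S
  maximum⇒unextendable {S = S} largest {v} v∉S two =
    <⇒≱ (p⊂q⇒∣p∣<∣q∣ (p⊆p∪q ⁅ v ⁆ , v , x∈p∪q⁺ (inj₂ (x∈⁅x⁆ v)) , v∉S)) (largest _ (_ , refl , two))

  -- One rotation takes `y`, `b` to `r`, `y`, and two take `b`, `r` there; a single color is
  -- absorbed into a pair containing it.
  complement-two-colored : ∀ {n} {c : EdgeColoring n} {S} → Cyclic c → UsesAtMostTwoColors c S →
    Unextendable c S → 4 ≤ ∣ S ∣ → UsesAtMostTwoColors c (∁ S)
  complement-two-colored {n} {c} {S} cyc (k , l , uses) maximal large = go k l uses cyc maximal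
    where
    Claim : EdgeColoring n → Set
    Claim d = Cyclic d → Unextendable d S → UsesAtMostTwoColors d (∁ S)
    red-yellow : ∀ d → Uses d S r y → Claim d
    red-yellow d uses cyc maximal = RedYellow.complement-two-colored d cyc S uses maximal large
    unrotate : ∀ d → Claim (rotate d) → Claim d
    unrotate d claim cyc maximal = unrotate-two-colored {c = d} (claim (rotate-cyclic {c = d} cyc)
      λ v∉S two → maximal v∉S (unrotate-two-colored {c = d} two))
    go : ∀ k l → Uses c S k l → Claim c
    go r r uses = red-yellow c λ u v u∈S v∈S u≢v → [ inj₁ , inj₁ ]′ (uses u v u∈S v∈S u≢v)
    go r y uses = red-yellow c uses
    go y r uses = red-yellow c λ u v u∈S v∈S u≢v → swap⊎ (uses u v u∈S v∈S u≢v)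
    go y y uses = red-yellow c λ u v u∈S v∈S u≢v → [ inj₂ , inj₂ ]′ (uses u v u∈S v∈S u≢v)
    go y b uses = unrotate c (red-yellow (rotate c) λ u v u∈S v∈S u≢v → map⊎ (cong next) (cong next) (uses u v u∈S v∈S u≢v))
    go b y uses = go y b λ u v u∈S v∈S u≢v → swap⊎ (uses u v u∈S v∈S u≢v)
    go b b uses = go y b λ u v u∈S v∈S u≢v → [ inj₂ , inj₂ ]′ (uses u v u∈S v∈S u≢v)
    go b r uses = unrotate c (unrotate (rotate c) (red-yellow (rotate (rotate c)) λ u v u∈S v∈S u≢v →
      map⊎ (cong (next ∘ next)) (cong (next ∘ next)) (uses u v u∈S v∈S u≢v)))
    go r b uses = go b r λ u v u∈S v∈S u≢v → swap⊎ (uses u v u∈S v∈S u≢v)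

  n≤2h₂ : ∀ {n s} {c : EdgeColoring n} → Cyclic c → h₂[ c ]≡ s → 4 ≤ s → n ≤ s + s
  n≤2h₂ {n} {c = c} cyc ((S , refl , two) , largest) large = begin
    n                       ≤⟨ m≤n+m∸n n ∣ S ∣ ⟩
    ∣ S ∣ + (n ∸ ∣ S ∣)     ≡⟨ cong (∣ S ∣ +_) (sym (∣∁p∣≡n∸∣p∣ S)) ⟩
    ∣ S ∣ + ∣ ∁ S ∣         ≤⟨ +-monoʳ-≤ ∣ S ∣ (largest _ (∁ S , refl ,
                                 complement-two-colored {c = c} {S = S} cyc two
                                   (maximum⇒unextendable {c = c} {S = S} largest) large)) ⟩
    ∣ S ∣ + ∣ S ∣           ∎
    where open ≤-Reasoning

  fiber : ∀ {n} → (Fin n → Color) → Color → Subset n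
  fiber f k = tabulate λ u → does (f u ≟ᶜ k)

  ∈-fiber⁻ : ∀ {n} (f : Fin n → Color) k {u} → u ∈ fiber f k → f u ≡ k
  ∈-fiber⁻ f k {u} u∈ with f u ≟ᶜ k | trans (sym (lookup∘tabulate (λ u → does (f u ≟ᶜ k)) u)) ([]=⇒lookup u∈)
  ... | yes e | _ = e
  ... | no _ | ()

  ∣fibers∣ : ∀ {n} (f : Fin n → Color) → ∣ fiber f r ∣ + ∣ fiber f b ∣ + ∣ fiber f y ∣ ≡ n
  ∣fibers∣ {zero} f = refl
  ∣fibers∣ {suc n} f with f zero | ∣fibers∣ (f ∘ suc)
  ... | r | e = cong suc e
  ... | b | e = trans (cong (_+ ∣ fiber (f ∘ suc) y ∣) (+-suc ∣ fiber (f ∘ suc) r ∣ _)) (cong suc e)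
  ... | y | e = trans (+-suc (∣ fiber (f ∘ suc) r ∣ + ∣ fiber (f ∘ suc) b ∣) _) (cong suc e)

  ≢next⇒ : ∀ {k l} → l ≢ next k → l ≡ k ⊎ l ≡ next (next k)
  ≢next⇒ {r} = ≢b⇒r⊎y
  ≢next⇒ {b} l≢y = swap⊎ (≢y⇒r⊎b l≢y)
  ≢next⇒ {y} l≢r = swap⊎ (≢r⇒b⊎y l≢r)

  -- Any two k-neighbours of a vertex are joined in a color other than next k.
  closed-neighbourhood-two-colored : ∀ {n} {c : EdgeColoring (suc n)} → Cyclic c → ∀ k →
    UsesAtMostTwoColors c (inside ∷ fiber (color c zero ∘ suc) k)
  closed-neighbourhood-two-colored {c = c} cyc k = k , next (next k) , uses
    where
    at-zero : ∀ {u} → suc u ∈ inside ∷ fiber (color c zero ∘ suc) k → color c zero (suc u) ≡ k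
    at-zero u∈ = ∈-fiber⁻ (color c zero ∘ suc) k (drop-there u∈)
    uses : Uses c (inside ∷ fiber (color c zero ∘ suc) k) k (next (next k))
    uses zero zero _ _ u≢v = contradiction refl u≢v
    uses zero (suc v) _ v∈ _ = inj₁ (at-zero v∈)
    uses (suc u) zero u∈ _ _ = inj₁ (trans (color-sym c _ _) (at-zero u∈))
    uses (suc u) (suc v) u∈ v∈ u≢v = ≢next⇒
      (cyc k (≢-sym 0≢1+n) 0≢1+n u≢v (trans (color-sym c _ _) (at-zero u∈)) (at-zero v∈))

  -- The vertices other than `zero` split into three color neighbourhoods, each becoming a
  -- two-colored set when `zero` is added.
  n≤3h₂-2 : ∀ {n s} {c : EdgeColoring (suc n)} → Cyclic c → h₂[ c ]≡ s → ∃[ t ] (s ≡ suc t × n ≤ t + t + t)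
  n≤3h₂-2 {s = zero} {c} cyc (_ , largest)
    with () ← largest _ (_ , refl , closed-neighbourhood-two-colored {c = c} cyc r)
  n≤3h₂-2 {n} {suc t} {c} cyc (_ , largest) = t , refl , (begin
    n                                           ≡⟨ sym (∣fibers∣ f) ⟩
    ∣ fiber f r ∣ + ∣ fiber f b ∣ + ∣ fiber f y ∣  ≤⟨ +-mono-≤ (+-mono-≤ (bound r) (bound b)) (bound y) ⟩
    t + t + t                                   ∎)
    where
    open ≤-Reasoning
    f : Fin n → Color
    f = color c zero ∘ suc
    bound : ∀ k → ∣ fiber f k ∣ ≤ t
    bound k = ≤-pred (largest _ (_ , refl , closed-neighbourhood-two-colored {c = c} cyc k))

  -- When `h₂` is 1, 2 or 3 there are at most 1, 4 or 7 vertices, and excluding 7 lowers the last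
  -- bound to 6. From 4 on, the complement bound applies.
  ⌈n/2⌉≤h₂ : ∀ {n s} {c : EdgeColoring n} → n ≢ 7 → Cyclic c → h₂[ c ]≡ s → ⌈ n /2⌉ ≤ s
  ⌈n/2⌉≤h₂ {zero} _ _ _ = z≤n
  ⌈n/2⌉≤h₂ {suc n} {s} {c} n≢7 cyc h with n≤3h₂-2 {c = c} cyc h
  ... | 0 , refl , n≤0 = ⌈n/2⌉-mono (s≤s n≤0)
  ... | 1 , refl , n≤3 = ⌈n/2⌉-mono (s≤s n≤3)
  ... | 2 , refl , n≤6 = ⌈n/2⌉-mono (≤-pred (≤∧≢⇒< (s≤s n≤6) n≢7))
  ... | suc (suc (suc t)) , refl , _ = ≤-trans
    (⌈n/2⌉-mono (n≤2h₂ {c = c} cyc h (s≤s (s≤s (s≤s (s≤s z≤n))))))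
    (≤-reflexive (sym (n≡⌈n+n/2⌉ s)))

  3≤h₂ : ∀ {s} {c : EdgeColoring 7} → Cyclic c → h₂[ c ]≡ s → 3 ≤ s
  3≤h₂ {c = c} cyc h with n≤3h₂-2 {c = c} cyc h
  ... | 0 , refl , ()
  ... | 1 , refl , s≤s (s≤s (s≤s ()))
  ... | suc (suc t) , refl , _ = s≤s (s≤s (s≤s z≤n))

  -- The matching coloring.

  parity : ∀ {n} → Fin n → Fin 2
  parity zero = zero
  parity (suc zero) = suc zero
  parity (suc (suc u)) = parity u

  -- Vertices 2i and 2i+1 are matched as pair i; for odd `n` the last vertex is alone in its pair.
  pair : ∀ {n} → Fin n → Fin ⌈ n /2⌉
  pair zero = zero
  pair {suc (suc n)} (suc zero) = zero
  pair {suc (suc n)} (suc (suc u)) = suc (pair u)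

  parity-pair-injective : ∀ {n} {u v : Fin n} → parity u ≡ parity v → pair u ≡ pair v → u ≡ v
  parity-pair-injective {u = zero} {zero} _ _ = refl
  parity-pair-injective {suc (suc n)} {zero} {suc zero} () _
  parity-pair-injective {suc (suc n)} {zero} {suc (suc v)} _ ()
  parity-pair-injective {suc (suc n)} {suc zero} {zero} () _
  parity-pair-injective {suc (suc n)} {suc zero} {suc zero} _ _ = refl
  parity-pair-injective {suc (suc n)} {suc zero} {suc (suc v)} _ ()
  parity-pair-injective {suc (suc n)} {suc (suc u)} {zero} _ ()
  parity-pair-injective {suc (suc n)} {suc (suc u)} {suc zero} _ ()
  parity-pair-injective {suc (suc n)} {suc (suc u)} {suc (suc v)} e f =
    cong (λ w → suc (suc w)) (parity-pair-injective e (suc-injective f))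

  -- Two red cliques (the parity classes), a yellow matching between them, and
  -- blue everywhere else.
  matching-color : ∀ {n} → Fin n → Fin n → Color
  matching-color u v with parity u ≟ parity v | pair u ≟ pair v
  ... | yes _ | _ = r
  ... | no _ | yes _ = y
  ... | no _ | no _ = b

  matching-color-sym : ∀ {n} (u v : Fin n) → matching-color u v ≡ matching-color v u
  matching-color-sym u v with parity u ≟ parity v | parity v ≟ parity u | pair u ≟ pair v | pair v ≟ pair u
  ... | yes _ | yes _ | _ | _ = refl
  ... | yes e | no f | _ | _ = contradiction (sym e) f
  ... | no f | yes e | _ | _ = contradiction (sym e) f
  ... | no _ | no _ | yes _ | yes _ = refl
  ... | no _ | no _ | yes e | no f = contradiction (sym e) f
  ... | no _ | no _ | no f | yes e = contradiction (sym e) f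
  ... | no _ | no _ | no _ | no _ = refl

  matching-coloring : ∀ n → EdgeColoring n
  matching-coloring n .color = matching-color
  matching-coloring n .color-sym = matching-color-sym

  same-parity⇒red : ∀ {n} {u v : Fin n} → parity u ≡ parity v → matching-color u v ≡ r
  same-parity⇒red {u = u} {v} e with parity u ≟ parity v
  ... | yes _ = refl
  ... | no f = contradiction e f

  red⇒same-parity : ∀ {n} {u v : Fin n} → matching-color u v ≡ r → parity u ≡ parity v
  red⇒same-parity {u = u} {v} e with parity u ≟ parity v | pair u ≟ pair v
  ... | yes f | _ = f
  red⇒same-parity () | no _ | yes _
  red⇒same-parity () | no _ | no _

  same-pair⇒yellow : ∀ {n} {u v : Fin n} → pair u ≡ pair v → u ≢ v → matching-color u v ≡ y
  same-pair⇒yellow {u = u} {v} e u≢v with parity u ≟ parity v | pair u ≟ pair v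
  ... | yes f | _ = contradiction (parity-pair-injective f e) u≢v
  ... | no _ | yes _ = refl
  ... | no _ | no f = contradiction e f

  yellow⇒same-pair : ∀ {n} {u v : Fin n} → matching-color u v ≡ y → pair u ≡ pair v
  yellow⇒same-pair {u = u} {v} e with parity u ≟ parity v | pair u ≟ pair v
  yellow⇒same-pair () | yes _ | _
  ... | no _ | yes f = f
  yellow⇒same-pair () | no _ | no _

  blue⇒opposite-parity : ∀ {n} {u v : Fin n} → matching-color u v ≡ b → parity u ≢ parity v
  blue⇒opposite-parity uv e with () ← trans (sym uv) (same-parity⇒red e)

  not-blue⇒same-pair : ∀ {n} {u v : Fin n} → matching-color u v ≢ b → parity u ≢ parity v → pair u ≡ pair v
  not-blue⇒same-pair uv≢b p≢ = [ (λ e → contradiction (red⇒same-parity e) p≢) , yellow⇒same-pair ]′ (≢b⇒r⊎y uv≢b)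

  opposite-opposite : {i j k : Fin 2} → i ≢ j → j ≢ k → i ≡ k
  opposite-opposite {zero} {zero} i≢j _ = contradiction refl i≢j
  opposite-opposite {zero} {suc zero} {zero} _ _ = refl
  opposite-opposite {zero} {suc zero} {suc zero} _ j≢k = contradiction refl j≢k
  opposite-opposite {suc zero} {zero} {zero} _ j≢k = contradiction refl j≢k
  opposite-opposite {suc zero} {zero} {suc zero} _ _ = refl
  opposite-opposite {suc zero} {suc zero} i≢j _ = contradiction refl i≢j

  -- Two red edges keep the parity, so the third is not blue; two blue edges switch it twice, so the
  -- third is red; two consecutive yellow edges would stay in one pair, which has no three vertices.
  matching-cyclic : ∀ n → Cyclic (matching-coloring n)
  matching-cyclic n r _ _ _ uv vw uw =
    blue⇒opposite-parity uw (trans (red⇒same-parity uv) (red⇒same-parity vw))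
  matching-cyclic n b _ _ _ uv vw uw
    with () ← trans (sym uw) (same-parity⇒red (opposite-opposite (blue⇒opposite-parity uv) (blue⇒opposite-parity vw)))
  matching-cyclic n y _ _ u≢w uv vw uw =
    u≢w (parity-pair-injective (red⇒same-parity uw) (trans (yellow⇒same-pair uv) (yellow⇒same-pair vw)))

  module MissingColor {n} (S : Subset n) where

    Misses : Color → Set
    Misses m = ∀ {u v} → u ∈ S → v ∈ S → u ≢ v → matching-color u v ≢ m

    via-parity : (∀ {u v} → u ∈ S → v ∈ S → parity u ≡ parity v → u ≡ v) → ∣ S ∣ ≤ 2
    via-parity inj = injective-on⇒∣p∣≤ S (λ u _ → parity u) inj

    via-pair : (∀ {u v} → u ∈ S → v ∈ S → pair u ≡ pair v → u ≡ v) → ∣ S ∣ ≤ ⌈ n /2⌉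
    via-pair inj = injective-on⇒∣p∣≤ S (λ u _ → pair u) inj

    -- Without red there is one vertex per parity, without yellow one per pair. Without blue, either
    -- all parities agree, or two opposite vertices force everything into their common pair.
    bound : 2 ≤ ⌈ n /2⌉ → ∀ m → Misses m → ∣ S ∣ ≤ ⌈ n /2⌉
    bound 2≤ r misses = ≤-trans (via-parity λ {u} {v} u∈S v∈S e →
      decidable-stable (u ≟ v) λ u≢v → misses u∈S v∈S u≢v (same-parity⇒red e)) 2≤
    bound 2≤ y misses = via-pair λ {u} {v} u∈S v∈S e →
      decidable-stable (u ≟ v) λ u≢v → misses u∈S v∈S u≢v (same-pair⇒yellow e u≢v)
    bound 2≤ b misses with any? (λ u → any? (λ v → (u ∈? S) ×-dec ((v ∈? S) ×-dec ¬? (parity u ≟ parity v))))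
    ... | no none = via-pair λ {u} {v} u∈S v∈S e → parity-pair-injective
      (decidable-stable (parity u ≟ parity v) λ p≢ → none (u , v , u∈S , v∈S , p≢)) e
    ... | yes (a , a′ , a∈S , a′∈S , a≢a′) = ≤-trans
      (via-parity λ u∈S v∈S e → parity-pair-injective e (trans (same-as-a u∈S) (sym (same-as-a v∈S)))) 2≤
      where
      opposite : ∀ {u v} → u ∈ S → v ∈ S → parity u ≢ parity v → pair u ≡ pair v
      opposite u∈S v∈S p≢ = not-blue⇒same-pair (misses u∈S v∈S (λ e → p≢ (cong parity e))) p≢
      same-as-a : ∀ {u} → u ∈ S → pair u ≡ pair a
      same-as-a {u} u∈S with parity u ≟ parity a
      ... | no p≢ = opposite u∈S a∈S p≢
      ... | yes e = trans (opposite u∈S a′∈S (λ f → a≢a′ (trans (sym e) f))) (sym (opposite a∈S a′∈S a≢a′))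

  evens : ∀ n → Subset n
  evens 0 = []
  evens 1 = inside ∷ []
  evens (suc (suc n)) = inside ∷ outside ∷ evens n

  ∣evens∣ : ∀ n → ∣ evens n ∣ ≡ ⌈ n /2⌉
  ∣evens∣ 0 = refl
  ∣evens∣ 1 = refl
  ∣evens∣ (suc (suc n)) = cong suc (∣evens∣ n)

  ∈-evens⁻ : ∀ n {u} → u ∈ evens n → parity u ≡ zero
  ∈-evens⁻ n {zero} _ = refl
  ∈-evens⁻ (suc (suc n)) {suc zero} (there ())
  ∈-evens⁻ (suc (suc n)) {suc (suc u)} (there (there u∈)) = ∈-evens⁻ n u∈

  -- For `n` equal to 2 the two vertices already form a two-colored set larger than `⌈ 2 /2⌉`; from
  -- 3 on, `⌈ n /2⌉` is at least 2, as `bound` requires.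
  h₂-matching : ∀ n → n ≢ 2 → h₂[ matching-coloring n ]≡ ⌈ n /2⌉
  h₂-matching n n≢2 =
    (evens n , ∣evens∣ n , r , r , λ u v u∈ v∈ _ → inj₁
      (same-parity⇒red (trans (∈-evens⁻ n u∈) (sym (∈-evens⁻ n v∈))))) ,
    upper n n≢2
    where
    upper : ∀ n → n ≢ 2 → ∀ k → HasTwoColoredSet (matching-coloring n) k → k ≤ ⌈ n /2⌉
    upper 0 _ _ (S , refl , _) = ∣p∣≤n S
    upper 1 _ _ (S , refl , _) = ∣p∣≤n S
    upper 2 n≢2 _ _ = contradiction refl n≢2
    upper (suc (suc (suc n))) _ _ (S , refl , k , l , uses) with missing-color k l
    ... | m , misses = MissingColor.bound S (s≤s (s≤s z≤n)) m
      λ {u} {v} u∈S v∈S u≢v → misses (uses u v u∈S v∈S u≢v)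

  -- The coloring for seven vertices.

  -- Each color class of this circulant coloring is a 7-cycle, so a set missing
  -- one of the colors is independent in a 7-cycle.
  distance-color : ℕ → Color
  distance-color 1 = r
  distance-color 2 = y
  distance-color 3 = b
  distance-color 4 = b
  distance-color 5 = y
  distance-color _ = r

  -- Distances d and 7 - d receive the same color, so the color depends only on the difference
  -- modulo 7 up to sign.
  heptagon : EdgeColoring 7
  heptagon .color u v = distance-color ∣ toℕ u - toℕ v ∣
  heptagon .color-sym u v = cong distance-color (∣-∣-comm (toℕ u) (toℕ v))

  heptagon-cyclic : Cyclic heptagon
  heptagon-cyclic {u} {v} {w} k u≢v v≢w u≢w refl vw = from-yes
    (all? λ u → all? λ v → all? λ w → ¬? (u ≟ v) →-dec (¬? (v ≟ w) →-dec (¬? (u ≟ w) →-dec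
      ((color heptagon v w ≟ᶜ color heptagon u v) →-dec
        ¬? (color heptagon u w ≟ᶜ next (color heptagon u v))))))
    u v w u≢v v≢w u≢w vw

  LargeMissing : Color → Subset 7 → Set
  LargeMissing m S = 4 ≤ ∣ S ∣ × (∀ u v → u ∈ S → v ∈ S → u ≢ v → color heptagon u v ≢ m)

  -- An exhaustive search through the 128 subsets of the seven vertices.
  large-missing? : ∀ m → Dec (∃ (LargeMissing m))
  large-missing? m = anySubset? λ S → (4 ≤? ∣ S ∣) ×-dec (all? λ u → all? λ v →
    (u ∈? S) →-dec ((v ∈? S) →-dec (¬? (u ≟ v) →-dec ¬? (color heptagon u v ≟ᶜ m))))

  no-large-missing : ∀ m → ¬ ∃ (LargeMissing m)
  no-large-missing r = from-no (large-missing? r)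
  no-large-missing b = from-no (large-missing? b)
  no-large-missing y = from-no (large-missing? y)

  h₂-heptagon : h₂[ heptagon ]≡ 3
  h₂-heptagon = (S₃ , refl , r , y , uses) , upper
    where
    S₃ : Subset 7
    S₃ = inside ∷ inside ∷ inside ∷ outside ∷ outside ∷ outside ∷ outside ∷ []
    uses : Uses heptagon S₃ r y
    uses = from-yes (all? λ u → all? λ v → (u ∈? S₃) →-dec ((v ∈? S₃) →-dec (¬? (u ≟ v) →-dec
      ((color heptagon u v ≟ᶜ r) ⊎-dec (color heptagon u v ≟ᶜ y)))))
    upper : ∀ k → HasTwoColoredSet heptagon k → k ≤ 3
    upper _ (S , refl , k , l , uses) with missing-color k l
    ... | m , misses = ≮⇒≥ λ large →
      no-large-missing m (S , large , λ u v u∈S v∈S u≢v → misses (uses u v u∈S v∈S u≢v))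

  -- The values of `h₂` for the forbidden family.

  forbidden-h₂ : ∀ n → n ≢ 2 → n ≢ 7 → h₂[_,_]≡_ n forbidden ⌈ n /2⌉
  forbidden-h₂ n n≢2 n≢7 =
    (matching-coloring n , Cyclic⇒∈Forb {c = matching-coloring n} (matching-cyclic n) , h₂-matching n n≢2) ,
    λ { k (c , free , h) → ⌈n/2⌉≤h₂ {c = c} n≢7 (∈Forb⇒Cyclic {c = c} free) h }

  forbidden-h₂-seven : h₂[_,_]≡_ 7 forbidden 3
  forbidden-h₂-seven =
    (heptagon , Cyclic⇒∈Forb {c = heptagon} heptagon-cyclic , h₂-heptagon) ,
    λ { k (c , free , h) → 3≤h₂ {c = c} (∈Forb⇒Cyclic {c = c} free) h }

lemma3p3 : let H = rrb ∷ bby ∷ yyr ∷ [] in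
    (∀ n → n ≢ 2 → n ≢ 7 → h₂[ n , H ]≡ ⌈ n /2⌉) × h₂[ 7 , H ]≡ 3
lemma3p3 = Data.Product._,_ forbidden-h₂ forbidden-h₂-seven
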